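{- For every integer $n\ge0$, $$\mathfrak{C}_n(x)=\sum_{k=0}^{n}k!\,x^k\sum_{j=0}^{n}\binom nj\left(-\frac k2\right)^j S(n-j,k),$$ where $S(m,k)$ denotes the Stirling numbers of the second kind (with $S(m,k)=0$ for $k>m$).
   Context: For $n\ge1$ the central factorial is $x^{[n]}=x\,(x+\tfrac n2-1)(x+\tfrac n2-2)\cdots(x-\tfrac n2+1)$ (a product of $n$ factors), and $x^{[0]}=1$. The central factorial numbers of the second kind $T(n,k)$ ($0\le k\le n$) are defined by $x^n=\sum_{k=0}^n T(n,k)\,x^{[k]}$; equivalently $T(n,k)=\frac1{k!}\sum_{j=0}^k(-1)^j\binom kj\left(\frac k2-j\right)^n$, and $T(n,k)=0$ for $k>n$. The $n$th central Fubini-like polynomial is $\mathfrak{C}_n(x)=\sum_{k=0}^n k!\,T(n,k)\,x^k$. Stirling numbers of the second kind are defined by $x^n=\sum_k S(n,k)\,x(x-1)\cdots(x-k+1)$. -}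

module Defs where

open import Algebra.Bundles using (RawSemiring)
open import Data.Fin.Base using (toℕ)
open import Data.Integer.Base using (+_)
open import Data.List.Base using (List; []; _∷_; map)
open import Data.Nat.Base as ℕ using (ℕ; zero; suc; _!)
open import Data.Product.Base using (_×_)
open import Data.Rational.Base
  using (ℚ; 0ℚ; 1ℚ; _+_; _*_; _-_; -_; _/_; +-*-rawSemiring)
open import Function.Base using (_∘_)
open import Level using (0ℓ)
open import Relation.Binary.PropositionalEquality.Core using (_≡_)

import Algebra.Definitions.RawSemiring as RawSemiringDefs

module ℚ^ = RawSemiringDefs +-*-rawSemiring

fromℕ : ℕ → ℚ
fromℕ n = + n / 1

half : ℕ → ℚ
half n = + n / 2

------------------------------------------------------------------------
-- ℚ[x]

-- Coefficients, constant term first.  Trailing zeros are allowed, so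
-- equality of polynomials is _≈_, not _≡_.
Poly : Set
Poly = List ℚ

coeff : Poly → ℕ → ℚ
coeff []      _       = 0ℚ
coeff (a ∷ p) zero    = a
coeff (a ∷ p) (suc i) = coeff p i

infix 4 _≈_
_≈_ : Poly → Poly → Set
p ≈ q = ∀ i → coeff p i ≡ coeff q i

infixl 6 _⊕_
_⊕_ : Poly → Poly → Poly
[]      ⊕ q       = q
(a ∷ p) ⊕ []      = a ∷ p
(a ∷ p) ⊕ (b ∷ q) = a + b ∷ p ⊕ q

infixr 7 _·_
_·_ : ℚ → Poly → Poly
c · p = map (c *_) p

infixl 7 _⊗_
_⊗_ : Poly → Poly → Poly
[]      ⊗ q = []
(a ∷ p) ⊗ q = a · q ⊕ (0ℚ ∷ p ⊗ q)

X+_ : ℚ → Poly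
X+ c = c ∷ 1ℚ ∷ []

X : Poly
X = X+ 0ℚ

polyRawSemiring : RawSemiring 0ℓ 0ℓ
polyRawSemiring = record
  { Carrier = Poly
  ; _≈_     = _≈_
  ; _+_     = _⊕_
  ; _*_     = _⊗_
  ; 0#      = []
  ; 1#      = 1ℚ ∷ []
  }

module Poly^ = RawSemiringDefs polyRawSemiring

-- Both endpoints of these sums are included.
∑ℚ : ℕ → (ℕ → ℚ) → ℚ
∑ℚ n f = ℚ^.sum {suc n} (f ∘ toℕ)

∑ₚ : ℕ → (ℕ → Poly) → Poly
∑ₚ n f = Poly^.sum {suc n} (f ∘ toℕ)

infixr 5 ∑ℚ ∑ₚ
syntax ∑ℚ n (λ k → e) = ∑ℚ[ k ≤ n ] e
syntax ∑ₚ n (λ k → e) = ∑ₚ[ k ≤ n ] e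

infixr 8 _^ℚ_ _^ₚ_
_^ℚ_ : ℚ → ℕ → ℚ
_^ℚ_ = ℚ^._^_

_^ₚ_ : Poly → ℕ → Poly
_^ₚ_ = Poly^._^_

------------------------------------------------------------------------
-- Factorial bases and the connection coefficients

-- x^{[n]} = x ∏_{i=1}^{n-1} (x + n/2 - i)
centralFactorial : ℕ → Poly
centralFactorial zero    = 1ℚ ∷ []
centralFactorial (suc m) =
  X ⊗ Poly^.product {m} (λ i → X+ (half (suc m) - fromℕ (suc (toℕ i))))

-- x (x - 1) ⋯ (x - n + 1)
fallingFactorial : ℕ → Poly
fallingFactorial n = Poly^.product {n} (λ i → X+ (- fromℕ (toℕ i)))

-- a is the array of coefficients of the monomials in the basis b,
-- extended by zero above the diagonal.
IsExpansion : (b : ℕ → Poly) (a : ℕ → ℕ → ℚ) → Set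
IsExpansion b a =
  (∀ n → X ^ₚ n ≈ ∑ₚ[ k ≤ n ] a n k · b k) ×
  (∀ {n k} → n ℕ.< k → a n k ≡ 0ℚ)

IsCentralFactorial₂ : (T : ℕ → ℕ → ℚ) → Set
IsCentralFactorial₂ = IsExpansion centralFactorial

IsStirling₂ : (S : ℕ → ℕ → ℚ) → Set
IsStirling₂ = IsExpansion fallingFactorial

centralFubini : (T : ℕ → ℕ → ℚ) → ℕ → Poly
centralFubini T n = ∑ₚ[ k ≤ n ] (fromℕ (k !) * T n k) · X ^ₚ k

{-# OPTIONS --safe #-}
-- Let Δ f x = f (x + 1) - f x and δ f x = f (x + ½) - f (x - ½).  Since
-- δ x^{[n]} = n x^{[n-1]}, applying δᵏ at 0 to the expansion of xⁿ in central
-- factorials gives k! T(n,k); likewise Δᵏ at 0 gives k! S(n,k).  As δᵏ f is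
-- Δᵏ of the translate f (x - k/2), expanding (x - k/2)ⁿ binomially expresses
-- k! T(n,k) through the numbers k! S(n-j,k).
module Submission where

open import Algebra.Bundles using (CommutativeRing)
open import Data.Fin.Base using (Fin; toℕ) renaming (zero to fzero; suc to fsuc)
import Data.Integer.Base as ℤ
open import Data.Integer.Tactic.RingSolver using (solve-∀)
open import Data.Nat.Base as ℕ using (ℕ; zero; suc; _!; _∸_; z≤n; s≤s)
open import Data.Nat.Combinatorics using (_C_)
open import Data.List.Base using ([]; _∷_)
open import Data.Product.Base using (_,_)
open import Data.Rational.Base
  using (ℚ; 0ℚ; 1ℚ; ½; -½; _+_; _*_; _-_; -_; fromℚᵘ)
open import Data.Rational.Properties
open import Data.Rational.Solver using (module +-*-Solver)
open import Data.Rational.Unnormalised.Base as ℚᵘ using (mkℚᵘ; *≡*)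
import Data.Rational.Unnormalised.Properties as ℚᵘ
open import Function.Base using (_∘_)
open import Relation.Binary.PropositionalEquality
  using (_≡_; refl; sym; trans; cong; cong₂; module ≡-Reasoning)
open import Defs

open import Algebra.Properties.Monoid.Sum *-1-monoid
  using () renaming (sum-cong-≗ to product-cong)
open import Algebra.Properties.Semiring.Sum
  (CommutativeRing.semiring +-*-commutativeRing)
  using (sum; sum-cong-≗; *-distribˡ-sum; sum-replicate-zero)
open import Algebra.Properties.Semiring.Mult
  (CommutativeRing.semiring +-*-commutativeRing) using (×1-homo-*; ×-assoc-*)
open import Algebra.Properties.CommutativeSemiring.Binomial
  (CommutativeRing.commutativeSemiring +-*-commutativeRing)
  renaming (theorem to binomialTheorem)

open ≡-Reasoning
open +-*-Solver using (solve; con; _:+_; _:*_; _:-_; :-_; _:=_)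

-- Naturals and half-integers inside the rationals.

fromℚᵘ-homo-+ : ∀ p q → fromℚᵘ (p ℚᵘ.+ q) ≡ fromℚᵘ p + fromℚᵘ q
fromℚᵘ-homo-+ p q = toℚᵘ-injective (ℚᵘ.≃-trans (toℚᵘ-fromℚᵘ (p ℚᵘ.+ q))
  (ℚᵘ.≃-sym (ℚᵘ.≃-trans (toℚᵘ-homo-+ (fromℚᵘ p) (fromℚᵘ q))
    (ℚᵘ.+-cong (toℚᵘ-fromℚᵘ p) (toℚᵘ-fromℚᵘ q)))))

-- `fromℕ` divides by a gcd that does not compute for a variable `n`. Passing through unnormalised
-- fractions turns the claim into an integer identity by cross-multiplication.
fromℕ-suc : ∀ n → fromℕ (suc n) ≡ 1ℚ + fromℕ n
fromℕ-suc n = trans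
  (fromℚᵘ-cong {mkℚᵘ (ℤ.+ suc n) 0} {mkℚᵘ (ℤ.+ 1) 0 ℚᵘ.+ mkℚᵘ (ℤ.+ n) 0}
    (*≡* (solve-ℤ (ℤ.+ n))))
  (fromℚᵘ-homo-+ (mkℚᵘ (ℤ.+ 1) 0) (mkℚᵘ (ℤ.+ n) 0))
  where
  solve-ℤ : ∀ i → (ℤ.1ℤ ℤ.+ i) ℤ.* ℤ.1ℤ ≡ (ℤ.1ℤ ℤ.* ℤ.1ℤ ℤ.+ i ℤ.* ℤ.1ℤ) ℤ.* ℤ.1ℤ
  solve-ℤ = solve-∀

half-suc : ∀ n → half (suc n) ≡ ½ + half n
half-suc n = trans
  (fromℚᵘ-cong {mkℚᵘ (ℤ.+ suc n) 1} {mkℚᵘ (ℤ.+ 1) 1 ℚᵘ.+ mkℚᵘ (ℤ.+ n) 1}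
    (*≡* (solve-ℤ (ℤ.+ n))))
  (fromℚᵘ-homo-+ (mkℚᵘ (ℤ.+ 1) 1) (mkℚᵘ (ℤ.+ n) 1))
  where
  -- The unnormalised sum of two halves has denominator 2 · 2, whence the 4.
  solve-ℤ : ∀ i → (ℤ.1ℤ ℤ.+ i) ℤ.* ℤ.+ 4 ≡
                  (ℤ.1ℤ ℤ.* ℤ.+ 2 ℤ.+ i ℤ.* ℤ.+ 2) ℤ.* ℤ.+ 2
  solve-ℤ = solve-∀

fromℕ≡half+half : ∀ n → fromℕ n ≡ half n + half n
fromℕ≡half+half zero    = refl
fromℕ≡half+half (suc n) = begin
  fromℕ (suc n)                ≡⟨ fromℕ-suc n ⟩
  1ℚ + fromℕ n                 ≡⟨ cong (1ℚ +_) (fromℕ≡half+half n) ⟩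
  1ℚ + (half n + half n)       ≡⟨ solve 1 (λ h → con 1ℚ :+ (h :+ h)
                                    := (con ½ :+ h) :+ (con ½ :+ h)) refl (half n) ⟩
  (½ + half n) + (½ + half n)  ≡⟨ cong₂ _+_ (half-suc n) (half-suc n) ⟨
  half (suc n) + half (suc n)  ∎

fromℕ≡×1 : ∀ n → fromℕ n ≡ n ℚ^.× 1ℚ
fromℕ≡×1 zero    = refl
fromℕ≡×1 (suc n) = trans (fromℕ-suc n) (cong (1ℚ +_) (fromℕ≡×1 n))

fromℕ-* : ∀ m n → fromℕ (m ℕ.* n) ≡ fromℕ m * fromℕ n
fromℕ-* m n = begin
  fromℕ (m ℕ.* n)            ≡⟨ fromℕ≡×1 (m ℕ.* n) ⟩
  (m ℕ.* n) ℚ^.× 1ℚ          ≡⟨ ×1-homo-* m n ⟩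
  (m ℚ^.× 1ℚ) * (n ℚ^.× 1ℚ)  ≡⟨ cong₂ _*_ (fromℕ≡×1 m) (fromℕ≡×1 n) ⟨
  fromℕ m * fromℕ n          ∎

×≡fromℕ* : ∀ n x → n ℚ^.× x ≡ fromℕ n * x
×≡fromℕ* n x = begin
  n ℚ^.× x            ≡⟨ cong (n ℚ^.×_) (*-identityˡ x) ⟨
  n ℚ^.× (1ℚ * x)     ≡⟨ ×-assoc-* n 1ℚ x ⟨
  (n ℚ^.× 1ℚ) * x     ≡⟨ cong (_* x) (fromℕ≡×1 n) ⟨
  fromℕ n * x         ∎

-- Polynomials as functions.

eval : Poly → ℚ → ℚ
eval []      x = 0ℚ
eval (a ∷ p) x = a + x * eval p x

-- Trailing zeros allow nonempty lists to be `≈ []`. This settles `eval-cong` once one of the two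
-- lists has run out.
eval-≈[] : ∀ p → p ≈ [] → ∀ x → eval p x ≡ 0ℚ
eval-≈[] []      p≈[] x = refl
eval-≈[] (a ∷ p) p≈[] x = begin
  a + x * eval p x  ≡⟨ cong₂ (λ u v → u + x * v) (p≈[] 0) (eval-≈[] p (p≈[] ∘ suc) x) ⟩
  0ℚ + x * 0ℚ       ≡⟨ solve 1 (λ x → con 0ℚ :+ x :* con 0ℚ := con 0ℚ) refl x ⟩
  0ℚ                ∎

eval-cong : ∀ p q → p ≈ q → ∀ x → eval p x ≡ eval q x
eval-cong []      q       p≈q x = sym (eval-≈[] q (sym ∘ p≈q) x)
eval-cong (a ∷ p) []      p≈q x = eval-≈[] (a ∷ p) p≈q x
eval-cong (a ∷ p) (b ∷ q) p≈q x =
  cong₂ (λ u v → u + x * v) (p≈q 0) (eval-cong p q (p≈q ∘ suc) x)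

eval-⊕ : ∀ p q x → eval (p ⊕ q) x ≡ eval p x + eval q x
eval-⊕ []      q       x = sym (+-identityˡ (eval q x))
eval-⊕ (a ∷ p) []      x = sym (+-identityʳ (eval (a ∷ p) x))
eval-⊕ (a ∷ p) (b ∷ q) x = begin
  (a + b) + x * eval (p ⊕ q) x             ≡⟨ cong (λ u → (a + b) + x * u) (eval-⊕ p q x) ⟩
  (a + b) + x * (eval p x + eval q x)      ≡⟨ solve 5 (λ a b x u v → (a :+ b) :+ x :* (u :+ v)
                                                := (a :+ x :* u) :+ (b :+ x :* v))
                                                refl a b x (eval p x) (eval q x) ⟩
  (a + x * eval p x) + (b + x * eval q x)  ∎

eval-· : ∀ c p x → eval (c · p) x ≡ c * eval p x
eval-· c []      x = sym (*-zeroʳ c)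
eval-· c (a ∷ p) x = begin
  c * a + x * eval (c · p) x  ≡⟨ cong (λ u → c * a + x * u) (eval-· c p x) ⟩
  c * a + x * (c * eval p x)  ≡⟨ solve 4 (λ c a x u → c :* a :+ x :* (c :* u)
                                   := c :* (a :+ x :* u)) refl c a x (eval p x) ⟩
  c * (a + x * eval p x)      ∎

eval-⊗ : ∀ p q x → eval (p ⊗ q) x ≡ eval p x * eval q x
eval-⊗ []      q x = sym (*-zeroˡ (eval q x))
eval-⊗ (a ∷ p) q x = begin
  eval (a · q ⊕ (0ℚ ∷ p ⊗ q)) x                ≡⟨ eval-⊕ (a · q) (0ℚ ∷ p ⊗ q) x ⟩
  eval (a · q) x + (0ℚ + x * eval (p ⊗ q) x)   ≡⟨ cong₂ (λ u v → u + (0ℚ + x * v)) (eval-· a q x) (eval-⊗ p q x) ⟩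
  a * eval q x + (0ℚ + x * (eval p x * eval q x))
    ≡⟨ solve 4 (λ a x u v → a :* v :+ (con 0ℚ :+ x :* (u :* v)) := (a :+ x :* u) :* v)
         refl a x (eval p x) (eval q x) ⟩
  (a + x * eval p x) * eval q x                ∎

eval-X+ : ∀ c x → eval (X+ c) x ≡ x + c
eval-X+ c x = solve 2 (λ c x → c :+ x :* (con 1ℚ :+ x :* con 0ℚ) := x :+ c) refl c x

eval-1 : ∀ x → eval (1ℚ ∷ []) x ≡ 1ℚ
eval-1 x = solve 1 (λ x → con 1ℚ :+ x :* con 0ℚ := con 1ℚ) refl x

eval-X^ : ∀ n x → eval (X ^ₚ n) x ≡ x ^ℚ n
eval-X^ zero    x = eval-1 x
eval-X^ (suc n) x = begin
  eval (X ⊗ X ^ₚ n) x         ≡⟨ eval-⊗ X (X ^ₚ n) x ⟩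
  eval X x * eval (X ^ₚ n) x  ≡⟨ cong₂ _*_ (trans (eval-X+ 0ℚ x) (+-identityʳ x)) (eval-X^ n x) ⟩
  x * x ^ℚ n                  ∎

eval-sum : ∀ {n} (p : Fin n → Poly) x →
           eval (Poly^.sum p) x ≡ sum (λ i → eval (p i) x)
eval-sum {zero}  p x = refl
eval-sum {suc n} p x = trans (eval-⊕ (p fzero) (Poly^.sum (p ∘ fsuc)) x)
  (cong (eval (p fzero) x +_) (eval-sum (p ∘ fsuc) x))

eval-product-X+ : ∀ {n} (c : Fin n → ℚ) x →
                  eval (Poly^.product (λ i → X+ c i)) x ≡ ℚ^.product (λ i → x + c i)
eval-product-X+ {zero}  c x = eval-1 x
eval-product-X+ {suc n} c x =
  trans (eval-⊗ (X+ c fzero) (Poly^.product (λ i → X+ c (fsuc i))) x)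
    (cong₂ _*_ (eval-X+ (c fzero) x) (eval-product-X+ (c ∘ fsuc) x))

-- Difference operators and expansions in basic sequences.

-- Two free shifts cover both cases at once: `Δ 1ℚ 0ℚ` is the forward difference and `Δ ½ -½` the
-- central one.
Δ : (a b : ℚ) → (ℚ → ℚ) → ℚ → ℚ
Δ a b f x = f (x + a) - f (x + b)

-- The new difference is applied innermost, so an induction on `k` rewrites the argument `f` and
-- passes it on through `Δ^-cong`, which takes the place of function extensionality.
Δ^ : (a b : ℚ) → ℕ → (ℚ → ℚ) → ℚ → ℚ
Δ^ a b zero    f = f
Δ^ a b (suc k) f = Δ^ a b k (Δ a b f)

module _ {a b : ℚ} where

  Δ^-cong : ∀ k {f g} → (∀ x → f x ≡ g x) → ∀ x → Δ^ a b k f x ≡ Δ^ a b k g x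
  Δ^-cong zero    f≗g = f≗g
  Δ^-cong (suc k) f≗g =
    Δ^-cong k (λ x → cong₂ _-_ (f≗g (x + a)) (f≗g (x + b)))

  Δ-linear : ∀ {n} (c : Fin n → ℚ) (f : Fin n → ℚ → ℚ) x →
             Δ a b (λ y → sum (λ i → c i * f i y)) x ≡ sum (λ i → c i * Δ a b (f i) x)
  Δ-linear {zero}  c f x = refl
  Δ-linear {suc n} c f x = begin
    (c₀ * u + s) - (c₀ * v + t)  ≡⟨ solve 5 (λ c u v s t → (c :* u :+ s) :- (c :* v :+ t)
                                      := c :* (u :- v) :+ (s :- t)) refl c₀ u v s t ⟩
    c₀ * (u - v) + (s - t)       ≡⟨ cong (c₀ * (u - v) +_) (Δ-linear (c ∘ fsuc) (f ∘ fsuc) x) ⟩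
    sum (λ i → c i * Δ a b (f i) x) ∎
    where
    c₀ = c fzero
    u = f fzero (x + a)
    v = f fzero (x + b)
    s = sum (λ i → c (fsuc i) * f (fsuc i) (x + a))
    t = sum (λ i → c (fsuc i) * f (fsuc i) (x + b))

  Δ^-linear : ∀ k {n} (c : Fin n → ℚ) (f : Fin n → ℚ → ℚ) x →
              Δ^ a b k (λ y → sum (λ i → c i * f i y)) x ≡
              sum (λ i → c i * Δ^ a b k (f i) x)
  Δ^-linear zero    c f x = refl
  Δ^-linear (suc k) c f x =
    trans (Δ^-cong k (Δ-linear c f) x) (Δ^-linear k c (Δ a b ∘ f) x)

-- A basic sequence in the sense of umbral calculus: it plays for Δ a b the
-- role of the monomials xⁿ for d/dx.
record IsBasicSequence (a b : ℚ) (p : ℕ → ℚ → ℚ) : Set where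
  field
    p₀≡1    : ∀ x → p 0 x ≡ 1ℚ
    vanish  : ∀ n → p (suc n) 0ℚ ≡ 0ℚ
    lowered : ∀ n x → Δ a b (p (suc n)) x ≡ fromℕ (suc n) * p n x

  -- The analogue of termwise differentiation: the constant `p 0` disappears, and every other term
  -- moves down one index and gains its old index as a factor.
  Δ-expansion : ∀ n (c : ℕ → ℚ) x →
    Δ a b (λ y → sum {suc n} (λ j → c (toℕ j) * p (toℕ j) y)) x ≡
    sum {n} (λ j → (c (suc (toℕ j)) * fromℕ (suc (toℕ j))) * p (toℕ j) x)
  Δ-expansion n c x = begin
    Δ a b (λ y → sum {suc n} (λ j → c (toℕ j) * p (toℕ j) y)) x
      ≡⟨ Δ-linear {n = suc n} (c ∘ toℕ) (p ∘ toℕ) x ⟩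
    c 0 * (p 0 (x + a) - p 0 (x + b)) + sum {n} (λ j → c (suc (toℕ j)) * Δ a b (p (suc (toℕ j))) x)
      ≡⟨ cong₂ _+_
           (trans (cong₂ (λ u v → c 0 * (u - v)) (p₀≡1 (x + a)) (p₀≡1 (x + b))) (*-zeroʳ (c 0)))
           (sum-cong-≗ {n} (λ j →
             trans (cong (c (suc (toℕ j)) *_) (lowered (toℕ j) x))
               (sym (*-assoc (c (suc (toℕ j))) (fromℕ (suc (toℕ j))) (p (toℕ j) x))))) ⟩
    0ℚ + sum {n} (λ j → (c (suc (toℕ j)) * fromℕ (suc (toℕ j))) * p (toℕ j) x)
      ≡⟨ +-identityˡ _ ⟩
    sum {n} (λ j → (c (suc (toℕ j)) * fromℕ (suc (toℕ j))) * p (toℕ j) x) ∎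

  -- The analogue of Taylor's formula: after `k` differences the former coefficient `c k` stands at
  -- `p 0` with the accumulated factor `k !`, and at 0 all other basic functions vanish. Here `n`
  -- counts the terms, so the hypothesis makes `c` zero past the end of the sum.
  Δ^-expansion : ∀ k n (c : ℕ → ℚ) → (∀ {j} → n ℕ.≤ j → c j ≡ 0ℚ) →
    Δ^ a b k (λ x → sum {n} (λ j → c (toℕ j) * p (toℕ j) x)) 0ℚ ≡ fromℕ (k !) * c k
  Δ^-expansion k zero c c≡0 = begin
    -- The zero function is an empty linear combination, so linearity alone disposes of it.
    Δ^ a b k (λ _ → 0ℚ) 0ℚ  ≡⟨ Δ^-linear k {0} (λ ()) (λ ()) 0ℚ ⟩
    0ℚ                      ≡⟨ *-zeroʳ (fromℕ (k !)) ⟨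
    fromℕ (k !) * 0ℚ        ≡⟨ cong (fromℕ (k !) *_) (c≡0 z≤n) ⟨
    fromℕ (k !) * c k       ∎
  Δ^-expansion zero (suc n) c c≡0 = begin
    c 0 * p 0 0ℚ + sum {n} (λ j → c (suc (toℕ j)) * p (suc (toℕ j)) 0ℚ)
      ≡⟨ cong₂ _+_ (cong (c 0 *_) (p₀≡1 0ℚ))
           (trans (sum-cong-≗ {n} (λ j →
             trans (cong (c (suc (toℕ j)) *_) (vanish (toℕ j))) (*-zeroʳ (c (suc (toℕ j))))))
             (sum-replicate-zero n)) ⟩
    c 0 * 1ℚ + 0ℚ  ≡⟨ solve 1 (λ c → c :* con 1ℚ :+ con 0ℚ := con 1ℚ :* c) refl (c 0) ⟩
    1ℚ * c 0       ∎
  Δ^-expansion (suc k) (suc n) c c≡0 = begin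
    Δ^ a b k (Δ a b (λ x → sum {suc n} (λ j → c (toℕ j) * p (toℕ j) x))) 0ℚ
      ≡⟨ Δ^-cong k (Δ-expansion n c) 0ℚ ⟩
    Δ^ a b k (λ x → sum {n} (λ j → c′ (toℕ j) * p (toℕ j) x)) 0ℚ
      ≡⟨ Δ^-expansion k n c′ (λ {j} n≤j →
           trans (cong (_* fromℕ (suc j)) (c≡0 (s≤s n≤j))) (*-zeroˡ (fromℕ (suc j)))) ⟩
    fromℕ (k !) * (c (suc k) * fromℕ (suc k))
      ≡⟨ solve 3 (λ f c s → f :* (c :* s) := (s :* f) :* c) refl
           (fromℕ (k !)) (c (suc k)) (fromℕ (suc k)) ⟩
    (fromℕ (suc k) * fromℕ (k !)) * c (suc k)
      ≡⟨ cong (_* c (suc k)) (fromℕ-* (suc k) (k !)) ⟨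
    fromℕ (suc k !) * c (suc k) ∎
    where
    c′ : ℕ → ℚ
    c′ j = c (suc j) * fromℕ (suc j)

-- Differences at 0 read off connection coefficients; both kinds of numbers are accessed only
-- through this formula.
Δ^-monomial : ∀ {a b} p A → IsBasicSequence a b (eval ∘ p) → IsExpansion p A →
  ∀ n k → Δ^ a b k (_^ℚ n) 0ℚ ≡ fromℕ (k !) * A n k
Δ^-monomial {a} {b} p A basic (expand , zero-above) n k = begin
  Δ^ a b k (_^ℚ n) 0ℚ
    ≡⟨ Δ^-cong k evaluated 0ℚ ⟩
  Δ^ a b k (λ x → sum {suc n} (λ j → A n (toℕ j) * eval (p (toℕ j)) x)) 0ℚ
    -- The sum has `suc n` terms, and `suc n ≤ j` is by definition the condition `n < j` of
    -- `zero-above`.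
    ≡⟨ IsBasicSequence.Δ^-expansion basic k (suc n) (A n) zero-above ⟩
  fromℕ (k !) * A n k ∎
  where
  evaluated : ∀ x → x ^ℚ n ≡ sum {suc n} (λ j → A n (toℕ j) * eval (p (toℕ j)) x)
  evaluated x = begin
    x ^ℚ n                                       ≡⟨ eval-X^ n x ⟨
    eval (X ^ₚ n) x                              ≡⟨ eval-cong (X ^ₚ n) (∑ₚ[ j ≤ n ] A n j · p j) (expand n) x ⟩
    eval (∑ₚ[ j ≤ n ] A n j · p j) x             ≡⟨ eval-sum {suc n} (λ j → A n (toℕ j) · p (toℕ j)) x ⟩
    sum {suc n} (λ j → eval (A n (toℕ j) · p (toℕ j)) x)
      ≡⟨ sum-cong-≗ {suc n} (λ j → eval-· (A n (toℕ j)) (p (toℕ j)) x) ⟩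
    sum {suc n} (λ j → A n (toℕ j) * eval (p (toℕ j)) x) ∎

-- Falling and central factorials as basic sequences.

infixl 8 _↓_
_↓_ : ℚ → ℕ → ℚ
x ↓ zero  = 1ℚ
x ↓ suc n = x * (x - 1ℚ) ↓ n

-- The definition splits off the largest factor, this lemma the smallest. Differencing uses both, to
-- expose the factors shared by two neighbouring falling powers.
↓-suc : ∀ n x → x ↓ suc n ≡ x ↓ n * (x - fromℕ n)
↓-suc zero    x = solve 1 (λ x → x :* con 1ℚ := con 1ℚ :* (x :- con 0ℚ)) refl x
↓-suc (suc n) x = begin
  x * (x - 1ℚ) ↓ suc n                       ≡⟨ cong (x *_) (↓-suc n (x - 1ℚ)) ⟩
  x * ((x - 1ℚ) ↓ n * ((x - 1ℚ) - fromℕ n))  ≡⟨ solve 3 (λ x u n → x :* (u :* ((x :- con 1ℚ) :- n))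
                                                  := (x :* u) :* (x :- (con 1ℚ :+ n)))
                                                  refl x ((x - 1ℚ) ↓ n) (fromℕ n) ⟩
  x ↓ suc n * (x - (1ℚ + fromℕ n))           ≡⟨ cong (λ m → x ↓ suc n * (x - m)) (fromℕ-suc n) ⟨
  x ↓ suc n * (x - fromℕ (suc n))            ∎

product≡↓ : ∀ n x → ℚ^.product {n} (λ i → x - fromℕ (toℕ i)) ≡ x ↓ n
product≡↓ zero    x = refl
product≡↓ (suc n) x = cong₂ _*_ (+-identityʳ x) (trans
  (product-cong {n} (λ i → trans (cong (λ m → x - m) (fromℕ-suc (toℕ i)))
    (solve 2 (λ x m → x :- (con 1ℚ :+ m) := (x :- con 1ℚ) :- m) refl x (fromℕ (toℕ i)))))
  (product≡↓ n (x - 1ℚ)))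

eval-fallingFactorial : ∀ n x → eval (fallingFactorial n) x ≡ x ↓ n
eval-fallingFactorial n x =
  trans (eval-product-X+ {n} (λ i → - fromℕ (toℕ i)) x) (product≡↓ n x)

-- Apart from `x`, the factors descend in unit steps from x + (n+1)/2 - 1 = x + n/2 - 1/2, so they
-- form a falling power of length `n`.
eval-centralFactorial : ∀ n x →
  eval (centralFactorial (suc n)) x ≡ x * (x + half n - ½) ↓ n
eval-centralFactorial n x = begin
  eval (centralFactorial (suc n)) x
    ≡⟨ eval-⊗ X (Poly^.product {n} (λ i → X+ c i)) x ⟩
  eval X x * eval (Poly^.product {n} (λ i → X+ c i)) x
    ≡⟨ cong₂ _*_ (trans (eval-X+ 0ℚ x) (+-identityʳ x)) (eval-product-X+ {n} c x) ⟩
  x * ℚ^.product {n} (λ i → x + c i)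
    ≡⟨ cong (x *_) (product-cong {n} shifted) ⟩
  x * ℚ^.product {n} (λ i → (x + half n - ½) - fromℕ (toℕ i))
    ≡⟨ cong (x *_) (product≡↓ n (x + half n - ½)) ⟩
  x * (x + half n - ½) ↓ n ∎
  where
  c : Fin n → ℚ
  c i = half (suc n) - fromℕ (suc (toℕ i))

  shifted : ∀ i → x + c i ≡ (x + half n - ½) - fromℕ (toℕ i)
  shifted i = begin
    x + (half (suc n) - fromℕ (suc (toℕ i)))
      ≡⟨ cong₂ (λ u v → x + (u - v)) (half-suc n) (fromℕ-suc (toℕ i)) ⟩
    x + ((½ + half n) - (1ℚ + fromℕ (toℕ i)))
      ≡⟨ solve 3 (λ x h m → x :+ ((con ½ :+ h) :- (con 1ℚ :+ m)) := ((x :+ h) :- con ½) :- m)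
           refl x (half n) (fromℕ (toℕ i)) ⟩
    (x + half n - ½) - fromℕ (toℕ i) ∎

fallingFactorial-basic : IsBasicSequence 1ℚ 0ℚ (eval ∘ fallingFactorial)
fallingFactorial-basic = record
  { p₀≡1    = eval-1
  ; vanish  = λ n → trans (eval-fallingFactorial (suc n) 0ℚ) (*-zeroˡ ((0ℚ - 1ℚ) ↓ n))
  ; lowered = lowered
  }
  where
  lowered : ∀ n x → Δ 1ℚ 0ℚ (eval (fallingFactorial (suc n))) x ≡
                    fromℕ (suc n) * eval (fallingFactorial n) x
  lowered n x = begin
    eval (fallingFactorial (suc n)) (x + 1ℚ) - eval (fallingFactorial (suc n)) (x + 0ℚ)
      ≡⟨ cong₂ _-_ (eval-fallingFactorial (suc n) (x + 1ℚ))
                   (trans (eval-fallingFactorial (suc n) (x + 0ℚ)) (cong (_↓ suc n) (+-identityʳ x))) ⟩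
    (x + 1ℚ) * (x + 1ℚ - 1ℚ) ↓ n - x ↓ suc n
      ≡⟨ cong₂ (λ y u → (x + 1ℚ) * y ↓ n - u)
           (solve 1 (λ x → (x :+ con 1ℚ) :- con 1ℚ := x) refl x) (↓-suc n x) ⟩
    (x + 1ℚ) * x ↓ n - x ↓ n * (x - fromℕ n)
      -- With the common factor `x ↓ n` removed, (x + 1) - (x - n) = n + 1 remains.
      ≡⟨ solve 3 (λ x u n → (x :+ con 1ℚ) :* u :- u :* (x :- n) := (con 1ℚ :+ n) :* u)
           refl x (x ↓ n) (fromℕ n) ⟩
    (1ℚ + fromℕ n) * x ↓ n
      ≡⟨ cong₂ _*_ (fromℕ-suc n) (eval-fallingFactorial n x) ⟨
    fromℕ (suc n) * eval (fallingFactorial n) x ∎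

centralFactorial-basic : IsBasicSequence ½ -½ (eval ∘ centralFactorial)
centralFactorial-basic = record
  { p₀≡1    = eval-1
  ; vanish  = λ n → trans (eval-centralFactorial n 0ℚ) (*-zeroˡ ((0ℚ + half n - ½) ↓ n))
  ; lowered = lowered
  }
  where
  lowered : ∀ n x → Δ ½ -½ (eval (centralFactorial (suc n))) x ≡
                    fromℕ (suc n) * eval (centralFactorial n) x
  -- `eval-centralFactorial` speaks only of positive indices, so the step down to index 0 is checked
  -- directly.
  lowered zero x = begin
    eval (centralFactorial 1) (x + ½) - eval (centralFactorial 1) (x + -½)
      ≡⟨ cong₂ _-_ (eval-centralFactorial 0 (x + ½)) (eval-centralFactorial 0 (x + -½)) ⟩
    (x + ½) * 1ℚ - (x + -½) * 1ℚ
      ≡⟨ solve 1 (λ x → (x :+ con ½) :* con 1ℚ :- (x :+ con -½) :* con 1ℚ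
           := con 1ℚ :* (con 1ℚ :+ x :* con 0ℚ)) refl x ⟩
    1ℚ * eval (centralFactorial 0) x ∎
  lowered (suc n) x = begin
    eval (centralFactorial (suc (suc n))) (x + ½) - eval (centralFactorial (suc (suc n))) (x + -½)
      ≡⟨ cong₂ _-_ (eval-centralFactorial (suc n) (x + ½)) (eval-centralFactorial (suc n) (x + -½)) ⟩
    (x + ½) * (x + ½ + half (suc n) - ½) ↓ suc n - (x + -½) * (x + -½ + half (suc n) - ½) ↓ suc n
      -- The shifts by ½ and -½ make the two falling powers start at w + 1 and w, so they share
      -- `w ↓ n`.
      ≡⟨ cong₂ (λ y z → (x + ½) * y ↓ suc n - (x + -½) * z ↓ suc n)
           (trans (cong (λ u → x + ½ + u - ½) (half-suc n))
             (solve 2 (λ x h → ((x :+ con ½) :+ (con ½ :+ h)) :- con ½ := ((x :+ h) :- con ½) :+ con 1ℚ)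
               refl x h))
           (trans (cong (λ u → x + -½ + u - ½) (half-suc n))
             (solve 2 (λ x h → ((x :+ con -½) :+ (con ½ :+ h)) :- con ½ := (x :+ h) :- con ½)
               refl x h)) ⟩
    (x + ½) * ((w + 1ℚ) * (w + 1ℚ - 1ℚ) ↓ n) - (x + -½) * w ↓ suc n
      ≡⟨ cong₂ (λ y u → (x + ½) * ((w + 1ℚ) * y ↓ n) - (x + -½) * u)
           (solve 1 (λ w → (w :+ con 1ℚ) :- con 1ℚ := w) refl w)
           (trans (↓-suc n w) (cong (λ m → w ↓ n * (w - m)) (fromℕ≡half+half n))) ⟩
    (x + ½) * ((w + 1ℚ) * w ↓ n) - (x + -½) * (w ↓ n * (w - (h + h)))
      -- What remains is (x + 1/2)(w + 1) - (x - 1/2)(w - n) = (n + 2) x. Writing n as `h + h` makes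
      -- it a polynomial identity in `x` and `h`.
      ≡⟨ solve 3 (λ x h u →
           (x :+ con ½) :* ((((x :+ h) :- con ½) :+ con 1ℚ) :* u)
             :- (x :+ con -½) :* (u :* (((x :+ h) :- con ½) :- (h :+ h)))
           := (con 1ℚ :+ (con 1ℚ :+ (h :+ h))) :* (x :* u))
           refl x h (w ↓ n) ⟩
    (1ℚ + (1ℚ + (h + h))) * (x * w ↓ n)
      ≡⟨ cong₂ _*_
           (trans (fromℕ-suc (suc n)) (cong (1ℚ +_)
             (trans (fromℕ-suc n) (cong (1ℚ +_) (fromℕ≡half+half n)))))
           (eval-centralFactorial n x) ⟨
    fromℕ (suc (suc n)) * eval (centralFactorial (suc n)) x ∎
    where
    h = half n
    w = x + half n - ½

-- From central to forward differences, and the identity.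

-- A central difference is a forward difference of the translate by -1/2, and the translations add
-- up. The order `- half k + y` makes the binomial theorem give exponent `j` to `- half k`.
Δ^-central≡forward : ∀ k f x →
  Δ^ ½ -½ k f x ≡ Δ^ 1ℚ 0ℚ k (λ y → f (- half k + y)) x
Δ^-central≡forward zero    f x = cong f (sym (+-identityˡ x))
Δ^-central≡forward (suc k) f x = begin
  Δ^ ½ -½ k (Δ ½ -½ f) x
    ≡⟨ Δ^-central≡forward k (Δ ½ -½ f) x ⟩
  Δ^ 1ℚ 0ℚ k (λ y → Δ ½ -½ f (- half k + y)) x
    -- Steps of ½ and -½ from -k/2 are steps of 1 and 0 from -(k+1)/2.
    ≡⟨ Δ^-cong k (λ y → cong₂ (λ u v → f u - f v)
         (trans (solve 2 (λ h y → (:- h :+ y) :+ con ½ := :- (con ½ :+ h) :+ (y :+ con 1ℚ)) refl (half k) y)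
           (cong (λ h → - h + (y + 1ℚ)) (sym (half-suc k))))
         (trans (solve 2 (λ h y → (:- h :+ y) :+ con -½ := :- (con ½ :+ h) :+ (y :+ con 0ℚ)) refl (half k) y)
           (cong (λ h → - h + (y + 0ℚ)) (sym (half-suc k))))) x ⟩
  Δ^ 1ℚ 0ℚ k (Δ 1ℚ 0ℚ (λ y → f (- half (suc k) + y))) x ∎

-- Each term is bracketed as a scalar times a power of `y`, the shape on which `Δ^-linear` acts.
^-binomial : ∀ n x y →
  (x + y) ^ℚ n ≡ sum {suc n} (λ j → (fromℕ (n C toℕ j) * x ^ℚ toℕ j) * y ^ℚ (n ∸ toℕ j))
^-binomial n x y = trans (binomialTheorem n x y) (sum-cong-≗ {suc n} (λ j →
  trans (×≡fromℕ* (n C toℕ j) _)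
    (sym (*-assoc (fromℕ (n C toℕ j)) (x ^ℚ toℕ j) (y ^ℚ (n ∸ toℕ j))))))

-- The factor `k !` stays on both sides: differences produce it, and the Fubini coefficients contain
-- it, so no division occurs.
centralFactorial₂≡stirling₂ : ∀ T S → IsCentralFactorial₂ T → IsStirling₂ S → ∀ n k →
  fromℕ (k !) * T n k ≡
  fromℕ (k !) * (∑ℚ[ j ≤ n ] fromℕ (n C j) * (- half k) ^ℚ j * S (n ∸ j) k)
centralFactorial₂≡stirling₂ T S isT isS n k = begin
  fromℕ (k !) * T n k
    ≡⟨ Δ^-monomial centralFactorial T centralFactorial-basic isT n k ⟨
  Δ^ ½ -½ k (_^ℚ n) 0ℚ
    ≡⟨ Δ^-central≡forward k (_^ℚ n) 0ℚ ⟩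
  Δ^ 1ℚ 0ℚ k (λ y → (- half k + y) ^ℚ n) 0ℚ
    ≡⟨ Δ^-cong k (^-binomial n (- half k)) 0ℚ ⟩
  Δ^ 1ℚ 0ℚ k (λ y → sum {suc n} (λ j → c j * y ^ℚ (n ∸ toℕ j))) 0ℚ
    ≡⟨ Δ^-linear k c (λ j → _^ℚ (n ∸ toℕ j)) 0ℚ ⟩
  sum (λ j → c j * Δ^ 1ℚ 0ℚ k (_^ℚ (n ∸ toℕ j)) 0ℚ)
    ≡⟨ sum-cong-≗ (λ j → trans
         -- This covers k > n - j as well, where `S (n ∸ j) k` is zero by the convention above the
         -- diagonal.
         (cong (c j *_) (Δ^-monomial fallingFactorial S fallingFactorial-basic isS (n ∸ toℕ j) k))
         (solve 3 (λ c f s → c :* (f :* s) := f :* (c :* s)) refl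
           (c j) (fromℕ (k !)) (S (n ∸ toℕ j) k))) ⟩
  sum (λ j → fromℕ (k !) * (c j * S (n ∸ toℕ j) k))
    ≡⟨ *-distribˡ-sum (fromℕ (k !)) (λ j → c j * S (n ∸ toℕ j) k) ⟨
  fromℕ (k !) * sum (λ j → c j * S (n ∸ toℕ j) k) ∎
  where
  c : Fin (suc n) → ℚ
  c j = fromℕ (n C toℕ j) * (- half k) ^ℚ toℕ j

sumₚ-cong : ∀ {n} {p q : Fin n → Poly} → (∀ i → p i ≡ q i) → Poly^.sum p ≡ Poly^.sum q
sumₚ-cong {zero}  p≗q = refl
sumₚ-cong {suc n} p≗q = cong₂ _⊕_ (p≗q fzero) (sumₚ-cong (p≗q ∘ fsuc))

theorem3 : (T S : ℕ → ℕ → ℚ) → IsCentralFactorial₂ T → IsStirling₂ S →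
    ∀ n →
    centralFubini T n ≈
    ∑ₚ[ k ≤ n ]
    (fromℕ (k !) *
    (∑ℚ[ j ≤ n ] fromℕ (n C j) * (- half k) ^ℚ j * S (n ∸ j) k))
    · X ^ₚ k
-- Corresponding scalars are equal rationals, so the two sides agree even as lists, and hence
-- coefficientwise.
theorem3 T S isT isS n i = cong (λ p → coeff p i) (sumₚ-cong {suc n} (λ k →
  cong (_· X ^ₚ toℕ k) (centralFactorial₂≡stirling₂ T S isT isS n (toℕ k))))
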